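{- Let $(\mathfrak{B},\beta)$ be a numbered subbasis for a set $X$ and $\mathring{\subseteq}$ a strong inclusion relation for the induced numbered basis $(\hat{\mathfrak{B}},\hat\beta)$. Suppose $\mathring{\subseteq}$ is semi-decidable and every point of $X$ admits a strong neighborhood basis. Then the basic open sets are uniformly c.e. open with respect to $\rho_{\beta}^{\mathring{\subseteq}}$, i.e. $\beta\le[\rho_{\beta}^{\mathring{\subseteq}}\rightarrow\rho_{\mathfrak{Si}}]$.
   Context: A numbered subbasis is a countable $\mathfrak{B}\subseteq\mathcal{P}(X)$ with a partial surjection $\beta:\subseteq\mathbb{N}\to\mathfrak{B}$. With $\Delta$ the standard numbering of finite subsets of $\mathbb{N}$: $\text{dom}(\hat\beta)=\{n:\Delta_n\subseteq\text{dom}(\beta)\}$, $\hat\beta(n)=\bigcap_{k\in\Delta_n}\beta(k)$ (empty intersection $=X$). A strong inclusion relation for $(\hat{\mathfrak{B}},\hat\beta)$ is a transitive relation $\mathring{\subseteq}$ on $\text{dom}(\hat\beta)$ with $b_1\mathring{\subseteq}b_2\Rightarrow\hat\beta(b_1)\subseteq\hat\beta(b_2)$; semi-decidable means there is an algorithm which, on $b_1,b_2\in\text{dom}(\hat\beta)$, halts iff $b_1\mathring{\subseteq}b_2$. $S\subseteq\text{dom}(\hat\beta)$ is a strong neighborhood basis of $x$ if $x\in\hat\beta(b)$ for all $b\in S$ and for each $b_1$ with $x\in\hat\beta(b_1)$ some $b_2\in S$ has $b_2\mathring{\subseteq}b_1$. The multi-representation $\rho=\rho_\beta^{\mathring{\subseteq}}:\subseteq\mathbb{N}^{\mathbb{N}}\rightrightarrows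 X$: $x\in\rho(f)$ iff $\text{Im}(f)$ is a strong neighborhood basis of $x$. The Sierpiński representation $[\rho\to\rho_{\mathfrak{Si}}]$ of open sets (of the final topology of $\rho$): $p$ is a name of $O\subseteq X$ iff $p$ encodes a pair $(e,q)$ with $e\in\mathbb{N}$, $q\in\mathbb{N}^{\mathbb{N}}$, such that the Type-2 Turing machine with code $e$ and oracle $q$, on input any $f\in\text{dom}(\rho)$, halts iff $\rho(f)\subseteq O$. The claim $\beta\le[\rho\to\rho_{\mathfrak{Si}}]$ means: there is a computable procedure mapping each $n\in\text{dom}(\beta)$ to a $[\rho\to\rho_{\mathfrak{Si}}]$-name of $\beta(n)$. -}

module Defs where

open import Data.Nat using (ℕ; zero; suc; _^_; _≡ᵇ_)
open import Data.Nat.DivMod using (_/_; _%_)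
open import Data.Nat.Properties using (m^n≢0)
open import Data.Bool using (Bool; true; false)
open import Data.List using (List; []; _∷_)
open import Data.Product using (Σ; ∃; _×_; _,_)
open import Relation.Binary.PropositionalEquality using (_≡_)
open import Function.Bundles using (_⇔_)

-- Standard numbering of finite subsets of ℕ:  k ∈ Δ n  iff bit k of n is 1.
_∈Δ_ : ℕ → ℕ → Set
k ∈Δ n = (n / (2 ^ k)) ⦃ m^n≢0 2 k ⦄ % 2 ≡ 1

-- A numbered subbasis on X: a partial numbering β :⊆ ℕ → P(X).
-- (𝔅 is the image of β, so surjectivity is automatic.)
record NumberedSubbasis (X : Set) : Set₁ where
  field
    domβ : ℕ → Set
    β    : (n : ℕ) → domβ n → X → Set

module _ {X : Set} (B : NumberedSubbasis X) where
  open NumberedSubbasis B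

  _∈β_ : X → ℕ → Set
  x ∈β n = Σ (domβ n) λ d → β n d x

  domβ̂ : ℕ → Set
  domβ̂ n = ∀ k → k ∈Δ n → domβ k

  _∈β̂_ : X → ℕ → Set
  x ∈β̂ n = ∀ k → k ∈Δ n → x ∈β k

  record StrongInclusion (R : ℕ → ℕ → Set) : Set where
    field
      trans : ∀ {a b c} → domβ̂ a → domβ̂ b → domβ̂ c → R a b → R b c → R a c
      sound : ∀ {a b} → domβ̂ a → domβ̂ b → R a b → ∀ x → x ∈β̂ a → x ∈β̂ b

  -- Semi-decidability: a (synthetically computable) stage-wise test
  -- s b₁ b₂ t = true  means "the algorithm halted on (b₁,b₂) within t steps".
  SemiDecidable : (ℕ → ℕ → Set) → Set
  SemiDecidable R = Σ (ℕ → ℕ → ℕ → Bool) λ s →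
    ∀ b₁ b₂ → domβ̂ b₁ → domβ̂ b₂ → (R b₁ b₂ ⇔ ∃ λ t → s b₁ b₂ t ≡ true)

  StrongNbhdBasis : (ℕ → ℕ → Set) → (ℕ → Set) → X → Set
  StrongNbhdBasis R S x =
    (∀ b → S b → domβ̂ b) ×
    (∀ b → S b → x ∈β̂ b) ×
    (∀ b₁ → domβ̂ b₁ → x ∈β̂ b₁ → ∃ λ b₂ → S b₂ × R b₂ b₁)

  ρ : (ℕ → ℕ → Set) → (ℕ → ℕ) → X → Set
  ρ R f x = StrongNbhdBasis R (λ b → ∃ λ i → f i ≡ b) x

  domρ : (ℕ → ℕ → Set) → (ℕ → ℕ) → Set
  domρ R f = ∃ λ x → ρ R f x

prefix : (ℕ → ℕ) → ℕ → List ℕ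
prefix f zero    = []
prefix f (suc k) = f 0 ∷ prefix (λ i → f (suc i)) k

-- Run of a Type-2 semi-decision machine with oracle: every oracle machine
-- (e,q) on input f is described by h : List ℕ → Bool ("has halted after
-- reading this prefix"), and halts on f iff h accepts some finite prefix.
Halts : (List ℕ → Bool) → (ℕ → ℕ) → Set
Halts h f = ∃ λ k → h (prefix f k) ≡ true

{-# OPTIONS --safe #-}
module Submission where

-- β(n) is the basic set β̂(2 ^ n).  A ρ-name f has all its points in a basic
-- set β̂(c) iff some f i is strongly included in c: one direction is the
-- soundness of the strong inclusion, the other is the strong neighbourhood
-- basis property at any point named by f.  As the strong inclusion is
-- semi-decidable, a machine can dovetail over all pairs (i, t) and accept as
-- soon as stage t of the test confirms f i ⊆̊ c; every such success is
-- visible on a finite prefix of f.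

open import Defs
open import Data.Nat using (ℕ)
open import Data.Bool using (Bool)
open import Data.List using (List)
open import Data.Product using (Σ; ∃; _×_)
open import Function.Bundles using (_⇔_)

open import Data.Bool.Base using (T; true)
open import Data.Bool.ListAction using (any)
open import Data.Bool.Properties using (T-≡)
open import Data.Empty using (⊥-elim)
open import Data.List.Base using (_∷_; length; applyUpTo; upTo)
open import Data.List.Membership.Propositional using (find; lose)
open import Data.List.Membership.Propositional.Properties using (∈-applyUpTo⁺; ∈-applyUpTo⁻)
open import Data.List.Properties using (length-applyUpTo)
open import Data.List.Relation.Unary.Any.Properties using (any⁺; any⁻)
open import Data.Nat.Base using (suc; _+_; _*_; _^_; _<_; s≤s; z≤n)
open import Data.Nat.DivMod using (_/_; _%_; n/n≡1; m*n/n≡m; m*n%n≡0; m<n⇒m/n≡0)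
open import Data.Nat.Properties using (0≢1+n; m^n≢0; ^-distribˡ-+-*; ^-monoʳ-<; *-comm; <-cmp; m≤n⇒∃[o]m+o≡n; +-comm; m≤m+n; m≤n+m)
open import Data.Product using (_,_; ∃₂)
open import Function.Base using (_∘_; id)
open import Function.Bundles using (mk⇔; Equivalence)
open import Function.Related.Propositional using (module EquationalReasoning)
open import Function.Construct.Symmetry using (⇔-sym)
open import Relation.Binary.Definitions using (tri<; tri≈; tri>)
open import Relation.Binary.PropositionalEquality using (_≡_; refl; sym; trans; cong; subst; module ≡-Reasoning)

∈Δ-2^-self : ∀ n → n ∈Δ (2 ^ n)
∈Δ-2^-self n = cong (_% 2) (n/n≡1 (2 ^ n) ⦃ m^n≢0 2 n ⦄)

2^[1+o+k]/2^k-even : ∀ o k → (2 ^ (suc o + k) / 2 ^ k) ⦃ m^n≢0 2 k ⦄ % 2 ≡ 0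
2^[1+o+k]/2^k-even o k = begin
  2 ^ (suc o + k) / 2 ^ k % 2  ≡⟨ cong (λ m → m / 2 ^ k % 2) (^-distribˡ-+-* 2 (suc o) k) ⟩
  2 ^ suc o * 2 ^ k / 2 ^ k % 2 ≡⟨ cong (_% 2) (m*n/n≡m (2 ^ suc o) (2 ^ k)) ⟩
  2 * 2 ^ o % 2                 ≡⟨ cong (_% 2) (*-comm 2 (2 ^ o)) ⟩
  2 ^ o * 2 % 2                 ≡⟨ m*n%n≡0 (2 ^ o) 2 ⟩
  0                             ∎
  where
  open ≡-Reasoning
  instance _ = m^n≢0 2 k

∈Δ-2^⇒≡ : ∀ {n k} → k ∈Δ (2 ^ n) → k ≡ n
∈Δ-2^⇒≡ {n} {k} k∈ with <-cmp k n
... | tri≈ _ k≡n _ = k≡n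
... | tri< k<n _ _ with o , refl ← m≤n⇒∃[o]m+o≡n k<n =
  ⊥-elim (0≢1+n (trans (sym (2^[1+o+k]/2^k-even o k)) k∈′))
  where
  k∈′ : k ∈Δ (2 ^ (suc o + k))
  k∈′ = subst (λ m → k ∈Δ (2 ^ m)) (cong suc (+-comm k o)) k∈
... | tri> _ _ n<k = ⊥-elim (0≢1+n (trans (sym bit-k≡0) k∈))
  where
  instance _ = m^n≢0 2 k
  bit-k≡0 : 2 ^ n / 2 ^ k % 2 ≡ 0
  bit-k≡0 = cong (_% 2) (m<n⇒m/n≡0 (^-monoʳ-< 2 (s≤s (s≤s z≤n)) n<k))

module _ {X : Set} (B : NumberedSubbasis X) where
  open NumberedSubbasis B

  domβ⇒domβ̂-2^ : ∀ {n} → domβ n → domβ̂ B (2 ^ n)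
  domβ⇒domβ̂-2^ dn k k∈ = subst domβ (sym (∈Δ-2^⇒≡ k∈)) dn

  ∈β̂-2^⇔∈β : ∀ {x n} → _∈β̂_ B x (2 ^ n) ⇔ _∈β_ B x n
  ∈β̂-2^⇔∈β {x} {n} = mk⇔ (λ x∈ → x∈ n (∈Δ-2^-self n))
                          (λ x∈ k k∈ → subst (_∈β_ B x) (sym (∈Δ-2^⇒≡ k∈)) x∈)

T-any-applyUpTo⇔ : ∀ (p : ℕ → Bool) f n → T (any p (applyUpTo f n)) ⇔ ∃ λ i → i < n × T (p (f i))
T-any-applyUpTo⇔ p f n = mk⇔ to (λ (i , i<n , pfi) → any⁺ p (lose (∈-applyUpTo⁺ f i<n) pfi))
  where
  to : T (any p (applyUpTo f n)) → ∃ λ i → i < n × T (p (f i))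
  to h with find (any⁻ p _ h)
  ... | _ , v∈ , pv with ∈-applyUpTo⁻ f v∈
  ...   | i , i<n , refl = i , i<n , pv

prefix≡applyUpTo : ∀ f k → prefix f k ≡ applyUpTo f k
prefix≡applyUpTo f 0       = refl
prefix≡applyUpTo f (suc k) = cong (f 0 ∷_) (prefix≡applyUpTo (f ∘ suc) k)

dovetail : (ℕ → ℕ → Bool) → List ℕ → Bool
dovetail g l = any (λ b → any (g b) (upTo (length l))) l

T-dovetail-applyUpTo⇔ : ∀ g f k →
  T (dovetail g (applyUpTo f k)) ⇔ ∃₂ λ i t → i < k × t < k × T (g (f i) t)
T-dovetail-applyUpTo⇔ g f k rewrite length-applyUpTo f k = mk⇔
  (λ h → let i , i<k , h′ = Equivalence.to (T-any-applyUpTo⇔ _ f k) h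
             t , t<k , gt = Equivalence.to (T-any-applyUpTo⇔ (g (f i)) id k) h′
         in i , t , i<k , t<k , gt)
  (λ (i , t , i<k , t<k , gt) → Equivalence.from (T-any-applyUpTo⇔ _ f k)
     (i , i<k , Equivalence.from (T-any-applyUpTo⇔ (g (f i)) id k) (t , t<k , gt)))

Halts-dovetail⇔ : ∀ g f → Halts (dovetail g) f ⇔ ∃₂ λ i t → g (f i) t ≡ true
Halts-dovetail⇔ g f = mk⇔ to from
  where
  T-dovetail-prefix⇔ : ∀ k → T (dovetail g (prefix f k)) ⇔ ∃₂ λ i t → i < k × t < k × T (g (f i) t)
  T-dovetail-prefix⇔ k rewrite prefix≡applyUpTo f k = T-dovetail-applyUpTo⇔ g f k
  to : Halts (dovetail g) f → ∃₂ λ i t → g (f i) t ≡ true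
  to (k , halted) with Equivalence.to (T-dovetail-prefix⇔ k) (Equivalence.from T-≡ halted)
  ... | i , t , _ , _ , gt = i , t , Equivalence.to T-≡ gt
  from : ∃₂ (λ i t → g (f i) t ≡ true) → Halts (dovetail g) f
  from (i , t , gt) = suc (i + t) , Equivalence.to T-≡
    (Equivalence.from (T-dovetail-prefix⇔ (suc (i + t)))
      (i , t , s≤s (m≤m+n i t) , s≤s (m≤n+m t i) , Equivalence.from T-≡ gt))

module _ {X : Set} (B : NumberedSubbasis X) {R : ℕ → ℕ → Set} where

  ∃stronglyBelow⇔∃accepted : ((s , _) : SemiDecidable B R) → ∀ {f c} → domρ B R f → domβ̂ B c →
    (∃ λ i → R (f i) c) ⇔ ∃₂ λ i t → s (f i) c t ≡ true
  ∃stronglyBelow⇔∃accepted (s , semidec) {f} {c} (_ , dom-im , _) dc = mk⇔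
    (λ (i , fi⊆c) → i , Equivalence.to (semidec (f i) c (dom-im (f i) (i , refl)) dc) fi⊆c)
    (λ (i , t , acc) → i , Equivalence.from (semidec (f i) c (dom-im (f i) (i , refl)) dc) (t , acc))

  module _ (SI : StrongInclusion B R) where
    open StrongInclusion SI

    ∃stronglyBelow⇔ρ⊆β̂ : ∀ {f c} → domρ B R f → domβ̂ B c →
      (∃ λ i → R (f i) c) ⇔ (∀ x → ρ B R f x → _∈β̂_ B x c)
    ∃stronglyBelow⇔ρ⊆β̂ {f} {c} (x₀ , ρfx₀@(_ , _ , basis)) dc = mk⇔ to from
      where
      to : (∃ λ i → R (f i) c) → ∀ x → ρ B R f x → _∈β̂_ B x c
      to (i , fi⊆c) x (dom-im , x∈im , _) =
        sound (dom-im (f i) (i , refl)) dc fi⊆c x (x∈im (f i) (i , refl))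
      from : (∀ x → ρ B R f x → _∈β̂_ B x c) → ∃ λ i → R (f i) c
      from ρ⊆c with _ , (i , refl) , fi⊆c ← basis c dc (ρ⊆c x₀ ρfx₀) = i , fi⊆c

proposition6p1 : {X : Set} (B : NumberedSubbasis X) (R : ℕ → ℕ → Set) →
    StrongInclusion B R →
    SemiDecidable B R →
    (∀ (x : X) → ∃ λ (S : ℕ → Set) → StrongNbhdBasis B R S x) →
    Σ (ℕ → List ℕ → Bool) λ name →
      ∀ n → NumberedSubbasis.domβ B n → ∀ (f : ℕ → ℕ) → domρ B R f →
        (Halts (name n) f ⇔ (∀ (x : X) → ρ B R f x → _∈β_ B x n))
-- The last hypothesis (every point has a strong neighbourhood basis) only
-- makes ρ surjective; correctness is only required on names in dom ρ.
proposition6p1 B R SI sd@(s , _) _ = name , correct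
  where
  name : ℕ → List ℕ → Bool
  name n = dovetail (λ b → s b (2 ^ n))
  correct : ∀ n → NumberedSubbasis.domβ B n → ∀ f → domρ B R f →
            Halts (name n) f ⇔ (∀ x → ρ B R f x → _∈β_ B x n)
  correct n dn f f∈domρ = begin
    Halts (name n) f                                ∼⟨ Halts-dovetail⇔ (λ b → s b c) f ⟩
    (∃₂ λ i t → s (f i) c t ≡ true)                 ∼⟨ ⇔-sym (∃stronglyBelow⇔∃accepted B sd f∈domρ dc) ⟩
    (∃ λ i → R (f i) c)                             ∼⟨ ∃stronglyBelow⇔ρ⊆β̂ B SI f∈domρ dc ⟩
    (∀ x → ρ B R f x → _∈β̂_ B x c)                 ∼⟨ ρ⊆β̂⇔ρ⊆β ⟩
    (∀ x → ρ B R f x → _∈β_ B x n)                  ∎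
    where
    open EquationalReasoning
    c : ℕ
    c = 2 ^ n
    dc : domβ̂ B c
    dc = domβ⇒domβ̂-2^ B dn
    ρ⊆β̂⇔ρ⊆β : (∀ x → ρ B R f x → _∈β̂_ B x c) ⇔ (∀ x → ρ B R f x → _∈β_ B x n)
    ρ⊆β̂⇔ρ⊆β = mk⇔ (λ h x ρfx → Equivalence.to (∈β̂-2^⇔∈β B) (h x ρfx))
                   (λ h x ρfx → Equivalence.from (∈β̂-2^⇔∈β B) (h x ρfx))
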